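{- Let $a$ and $b$ be relatively prime positive integers and let $n$ be a nonnegative integer. Then the number of zero-sum words of length $(a+b)n$ in the alphabet $\{+a,-b\}$ that contain no illegal subword is $\binom{a+b}{a}^n$.
   Context: A word in the alphabet $\{+a,-b\}$ is a finite sequence $w=w_1w_2\cdots w_m$ with each $w_i\in\{+a,-b\}$; it is zero-sum if $\sum_i w_i=0$. A consecutive subword $w_iw_{i+1}\cdots w_j$ ($1\le i\le j\le m$) of $w$ is called illegal if it is zero-sum, its first letter $w_i$ is $+a$, and the letter immediately following it in $w$ exists and equals $-b$ (i.e. $j<m$ and $w_{j+1}=-b$). -}

module Defs where

open import Data.Nat using (ℕ; zero; suc; _+_; _*_; _≤_; _<_)
open import Data.Integer using (ℤ; +_; -_) renaming (_+_ to _+ℤ_)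
open import Data.Fin using (Fin; toℕ)
open import Data.Vec using (Vec; []; _∷_; lookup)
open import Data.Product using (Σ; _×_; ∃; ∃-syntax)
open import Relation.Binary.PropositionalEquality using (_≡_)

data Letter : Set where
  plusA  : Letter
  minusB : Letter

val : ℕ → ℕ → Letter → ℤ
val a b plusA  = + a
val a b minusB = - (+ b)

-- Sum of the letters w_i, with i ranging over positions  i ≤ k < j  (0-indexed, half-open).
-- segSum a b w i j = Σ_{i ≤ k < j} w_k
segSum : ℕ → ℕ → {m : ℕ} → Vec Letter m → ℕ → ℕ → ℤ
segSum a b [] i j = + 0
segSum a b (x ∷ w) zero zero = + 0
segSum a b (x ∷ w) zero (suc j) = val a b x +ℤ segSum a b w zero j
segSum a b (x ∷ w) (suc i) zero = + 0
segSum a b (x ∷ w) (suc i) (suc j) = segSum a b w i j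

wordSum : ℕ → ℕ → {m : ℕ} → Vec Letter m → ℤ
wordSum a b [] = + 0
wordSum a b (x ∷ w) = val a b x +ℤ wordSum a b w

ZeroSum : ℕ → ℕ → {m : ℕ} → Vec Letter m → Set
ZeroSum a b w = wordSum a b w ≡ + 0

IllegalAt : ℕ → ℕ → {m : ℕ} → Vec Letter m → Fin m → Fin m → Set
IllegalAt a b w i j =
  (toℕ i ≤ toℕ j) × (segSum a b w (toℕ i) (suc (toℕ j)) ≡ + 0)
  × (lookup w i ≡ plusA)
  × (Σ (Fin _) λ k → (toℕ k ≡ suc (toℕ j)) × (lookup w k ≡ minusB))

HasIllegal : ℕ → ℕ → {m : ℕ} → Vec Letter m → Set
HasIllegal a b w = ∃[ i ] ∃[ j ] IllegalAt a b w i j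

{-# OPTIONS --safe #-}
module Submission where

open import Defs
open import Data.Nat as ℕ using (ℕ; zero; suc; pred; _+_; _*_; _∸_; _^_; _≤_; _<_; z≤n; s≤s; s≤s⁻¹; NonZero)
open import Data.Nat.Properties using
  ( _<?_; _≤?_; _≟_; +-monoʳ-≤; +-cancelˡ-≤; ≤-refl; ≤-reflexive; ≤-trans; <-≤-trans; ≤-<-trans;
    <-trans; <-irrefl; <⇒≤; <⇒≱; ≮⇒≥; ≰⇒>; <-cmp; ≤∧≢⇒<; m≤m+n; m≤n+m; n≤1+n; n<1+n; +-comm; +-assoc;
    +-suc; +-identityʳ; *-suc; *-comm; *-cancelʳ-≡; +-monoˡ-≤; +-monoʳ-<; +-monoˡ-<; +-cancelʳ-≡;
    +-cancelˡ-≡; +-cancelʳ-≤; +-cancelʳ-<; m+[n∸m]≡n; m∸n+n≡m; m+n∸n≡m; suc-pred; m≤n⇒m<n∨m≡n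
  )
open import Data.Nat.DivMod using
  ( _/_; _%_; m≡m%n+[m/n]*n; m%n<n; m<n⇒m%n≡m; [m+n]%n≡m%n; [m+kn]%n≡m%n; m%n%n≡m%n; %-distribˡ-+
  )
import Data.Nat.Properties as ℕₚ
open import Data.Nat.GCD using (gcd)
open import Data.Nat.Combinatorics using (_C_; nCk≡nC[n∸k]; nCn≡1; nCk+nC[k+1]≡[n+1]C[k+1])
import Data.Nat.Coprimality as Coprimality
open import Data.Nat.Coprimality using (Coprime; coprime-divisor; coprime-+; gcd≡1⇒coprime)
open import Data.Nat.Divisibility using (_∣_; divides)
open import Data.Nat.Tactic.RingSolver using () renaming (solve-∀ to ℕ-solve-∀)
open import Data.Integer.Tactic.RingSolver using (solve-∀)
open import Data.Fin as Fin using (Fin; toℕ; fromℕ<)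
open import Data.Fin.Properties using (toℕ<n; toℕ-fromℕ<; +↔⊎; *↔×)
open import Data.Vec using (Vec; []; _∷_; lookup)
open import Data.Product.Function.NonDependent.Propositional using (_×-↔_)
open import Data.Sum.Function.Propositional using (_⊎-↔_)
open import Function.Bundles using (_↔_; mk↔ₛ′)
open import Function.Properties.Inverse using (↔-refl; ↔-sym; ↔-trans)
open import Axiom.UniquenessOfIdentityProofs using (module Decidable⇒UIP)
open import Data.Integer as ℤ using (ℤ; _⊖_; 0ℤ)
import Data.Integer.Properties as ℤ
open import Data.Product using (Σ; ∃; ∃-syntax; _×_; _,_; proj₁; proj₂)
open import Data.Sum using (_⊎_; inj₁; inj₂)
open import Data.Empty using (⊥; ⊥-elim)
open import Function using (_∘_)
open import Relation.Binary using (tri<; tri≈; tri>; Transitive)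
open import Relation.Nullary using (¬_; yes; no)
open import Relation.Binary.PropositionalEquality using
  ( _≡_; refl; sym; trans; cong; cong₂; subst; subst₂; module ≡-Reasoning
  )
open import Algebra.Properties.AbelianGroup ℤ.+-0-abelianGroup using (∙-cancelˡ; ∙-cancelʳ)
open import Algebra.Properties.CommutativeSemigroup ℕₚ.+-commutativeSemigroup using (x∙yz≈y∙xz)

-- Put p = a + b.  By coprimality a factor is zero-sum iff, for some q, it has length q p and q a letters −b.
-- Legal words of length p (n + 1) correspond to pairs of a legal word v of length p n and one of the
-- (a + b) C a zero-sum words ℓ of length p.  From (v , ℓ), let c be the periodic word ℓ ℓ ℓ …, let k be the
-- first position at which (number of −b in v before k) − (number of −b in c before k) is maximal, and insert
-- the letters of c at positions k, …, k + p − 1 into v at k.  Conversely, a zero-sum word has a zero-sum factor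
-- of length p, because the sums of consecutive windows of length p differ by 0 or ± p; cutting the first one
-- out of a legal word gives back v and, after extending it periodically, c.  Legality forces that excess of −b
-- to stay at or below its value on the window from there on, and since it is 0 at both ends of the word it has
-- to be strictly smaller before the window.

-- Counting −b

Seq : Set
Seq = ℕ → Letter

downs : Letter → ℕ
downs plusA  = 0
downs minusB = 1

downs≤1 : ∀ x → downs x ≤ 1
downs≤1 plusA  = z≤n
downs≤1 minusB = ≤-refl

count : Seq → ℕ → ℕ
count f zero    = 0
count f (suc m) = downs (f m) + count f m

count-cong : ∀ {f g} m → (∀ {t} → t < m → f t ≡ g t) → count f m ≡ count g m
count-cong zero    eq = refl
count-cong (suc m) eq = cong₂ (λ x n → downs x + n) (eq ≤-refl)
  (count-cong m (eq ∘ λ t<m → ≤-trans t<m (n≤1+n m)))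

count-suc≥ : ∀ f m → count f m ≤ count f (suc m)
count-suc≥ f m = m≤n+m (count f m) (downs (f m))

count-suc≤ : ∀ f m → count f (suc m) ≤ suc (count f m)
count-suc≤ f m = +-monoˡ-≤ (count f m) (downs≤1 (f m))

count-suc-cong : ∀ {f g} {i j e} → f i ≡ g j → count f i ≡ count g j + e → count f (suc i) ≡ count g (suc j) + e
count-suc-cong {f} {g} {i} {j} {e} eq eqc = trans
  (cong₂ (λ x n → downs x + n) eq eqc) (sym (+-assoc (downs (g j)) (count g j) e))

-- Excess of −b letters of one sequence over another

excess : Seq → Seq → ℕ → ℤ
excess f c m = count f m ⊖ count c m

stepℤ : Letter → Letter → ℤ → ℤ
stepℤ plusA  plusA  x = x
stepℤ plusA  minusB x = ℤ.pred x
stepℤ minusB plusA  x = ℤ.suc x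
stepℤ minusB minusB x = x

excess-suc : ∀ f c m → excess f c (suc m) ≡ stepℤ (f m) (c m) (excess f c m)
excess-suc f c m with f m | c m
... | plusA  | plusA  = refl
... | plusA  | minusB = sym (ℤ.distribʳ-⊖-+-neg 0 (count f m) (count c m))
... | minusB | plusA  = sym (ℤ.distribʳ-⊖-+-pos 1 (count f m) (count c m))
... | minusB | minusB = ℤ.[1+m]⊖[1+n]≡m⊖n (count f m) (count c m)

excess-suc-cong : ∀ {f g c d} {i j} → f i ≡ g j → c i ≡ d j → excess f c i ≡ excess g d j →
  excess f c (suc i) ≡ excess g d (suc j)
excess-suc-cong {f} {g} {c} {d} {i} {j} eqf eqc eq = begin
  excess f c (suc i)                  ≡⟨ excess-suc f c i ⟩
  stepℤ (f i) (c i) (excess f c i)    ≡⟨ cong₂ (λ x y → stepℤ x y (excess f c i)) eqf eqc ⟩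
  stepℤ (g j) (d j) (excess f c i)    ≡⟨ cong (stepℤ (g j) (d j)) eq ⟩
  stepℤ (g j) (d j) (excess g d j)    ≡⟨ excess-suc g d j ⟨
  excess g d (suc j)                  ∎
  where open ≡-Reasoning

stepℤ-diag : ∀ x z → stepℤ x x z ≡ z
stepℤ-diag plusA  z = refl
stepℤ-diag minusB z = refl

excess-suc-same : ∀ f c m → f m ≡ c m → excess f c (suc m) ≡ excess f c m
excess-suc-same f c m eq = trans (excess-suc f c m)
  (trans (cong (λ x → stepℤ x (c m) (excess f c m)) eq) (stepℤ-diag (c m) _))

-- One step changes the excess by at most 1, so the bound z can be passed only from z itself, by -b
-- in f against +a in c.
excess-suc-≤ : ∀ f c m {z} → excess f c m ℤ.≤ z →
  (f m ≡ minusB → c m ≡ plusA → excess f c m ≡ z → ⊥) → excess f c (suc m) ℤ.≤ z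
excess-suc-≤ f c m {z} le no-up = subst (ℤ._≤ z) (sym (excess-suc f c m)) (go (f m) (c m) no-up)
  where
  go : ∀ x y → (x ≡ minusB → y ≡ plusA → excess f c m ≡ z → ⊥) → stepℤ x y (excess f c m) ℤ.≤ z
  go plusA  plusA  h = le
  go plusA  minusB h = ℤ.i≤j⇒pred[i]≤j le
  go minusB plusA  h = ℤ.i<j⇒suc[i]≤j (ℤ.≤∧≢⇒< le (h refl refl))
  go minusB minusB h = le

excess-suc-up : ∀ f c m → f m ≡ minusB → c m ≡ plusA → excess f c m ℤ.< excess f c (suc m)
excess-suc-up f c m ef ec = ℤ.suc[i]≤j⇒i<j (ℤ.≤-reflexive (sym
  (trans (excess-suc f c m) (cong₂ (λ x y → stepℤ x y (excess f c m)) ef ec))))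

-- Where c gains e letters -b, comparing the excesses at both ends means comparing the gain of f
-- with e: over the common subtrahend `e + count c i` only the counts of f differ.
module _ (f c : Seq) (i j : ℕ) {e : ℕ} (gain : count c j ≡ count c i + e) where

  private
    lhs : excess f c j ≡ count f j ⊖ (e + count c i)
    lhs = cong (count f j ⊖_) (trans gain (+-comm (count c i) e))

    rhs : excess f c i ≡ (count f i + e) ⊖ (e + count c i)
    rhs = sym (trans (cong (_⊖ (e + count c i)) (+-comm (count f i) e)) (ℤ.+-cancelˡ-⊖ e (count f i) (count c i)))

  excess-≡ : count f j ≡ count f i + e → excess f c j ≡ excess f c i
  excess-≡ eq = trans lhs (trans (cong (_⊖ (e + count c i)) eq) (sym rhs))

  excess-≤ : count f j ≤ count f i + e → excess f c j ℤ.≤ excess f c i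
  excess-≤ le = subst₂ ℤ._≤_ (sym lhs) (sym rhs) (ℤ.⊖-monoˡ-≤ (e + count c i) le)

  excess-< : count f j < count f i + e → excess f c j ℤ.< excess f c i
  excess-< lt = subst₂ ℤ._<_ (sym lhs) (sym rhs) (ℤ.⊖-monoˡ-< (e + count c i) lt)

  excess-> : count f i + e < count f j → excess f c i ℤ.< excess f c j
  excess-> lt = subst₂ ℤ._<_ (sym rhs) (sym lhs) (ℤ.⊖-monoˡ-< (e + count c i) lt)

  excess-≡⁻¹ : excess f c j ≡ excess f c i → count f j ≡ count f i + e
  excess-≡⁻¹ eq with <-cmp (count f j) (count f i + e)
  ... | tri< lt _ _ = ⊥-elim (ℤ.<-irrefl eq (excess-< lt))
  ... | tri≈ _ eq′ _ = eq′
  ... | tri> _ _ gt = ⊥-elim (ℤ.<-irrefl (sym eq) (excess-> gt))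

  excess-≤⁻¹ : excess f c j ℤ.≤ excess f c i → count f j ≤ count f i + e
  excess-≤⁻¹ le with count f j ≤? count f i + e
  ... | yes le′ = le′
  ... | no  nle = ⊥-elim (ℤ.<⇒≱ (excess-> (≰⇒> nle)) le)

-- Arithmetic progressions

infixl 6 _+[_]_

-- x +[ s ] q is x + q s, bracketed as ((x + s) + s) + … so that peeling off the last summand is definitional.
_+[_]_ : ℕ → ℕ → ℕ → ℕ
x +[ s ] zero  = x
x +[ s ] suc q = (x +[ s ] q) + s

+[]≡+* : ∀ x s q → x +[ s ] q ≡ x + q * s
+[]≡+* x s zero    = sym (+-identityʳ x)
+[]≡+* x s (suc q) = begin
  (x +[ s ] q) + s  ≡⟨ cong (_+ s) (+[]≡+* x s q) ⟩
  x + q * s + s     ≡⟨ +-assoc x (q * s) s ⟩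
  x + (q * s + s)   ≡⟨ cong (λ y → x + y) (+-comm (q * s) s) ⟩
  x + suc q * s     ∎
  where open ≡-Reasoning

+[]-shift : ∀ x s q → (x + s) +[ s ] q ≡ (x +[ s ] q) + s
+[]-shift x s zero    = refl
+[]-shift x s (suc q) = cong (_+ s) (+[]-shift x s q)

x≤x+[] : ∀ x s q → x ≤ x +[ s ] q
x≤x+[] x s q = ≤-trans (m≤m+n x (q * s)) (≤-reflexive (sym (+[]≡+* x s q)))

-- First occurrence and first maximum

FirstMax : (ℕ → ℤ) → ℕ → ℕ → Set
FirstMax g N k = k ≤ N × (∀ {m} → m < k → g m ℤ.< g k) × (∀ {m} → m ≤ N → g m ℤ.≤ g k)

firstMax : ∀ g N → ∃ (FirstMax g N)
firstMax g zero = 0 , z≤n , (λ ()) , λ { z≤n → ℤ.≤-refl }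
firstMax g (suc N) with firstMax g N
... | k , k≤N , before , all with g (suc N) ℤ.≤? g k
-- On a tie the earlier position is kept, which preserves the strict inequality before k.
...   | yes le = k , ≤-trans k≤N (n≤1+n N) , before , all′
  where
  all′ : ∀ {m} → m ≤ suc N → g m ℤ.≤ g k
  all′ m≤ with m≤n⇒m<n∨m≡n m≤
  ... | inj₁ m< = all (s≤s⁻¹ m<)
  ... | inj₂ refl = le
...   | no nle = suc N , ≤-refl , (λ m< → ℤ.≤-<-trans (all (s≤s⁻¹ m<)) (ℤ.≰⇒> nle)) , all′
  where
  all′ : ∀ {m} → m ≤ suc N → g m ℤ.≤ g (suc N)
  all′ m≤ with m≤n⇒m<n∨m≡n m≤
  ... | inj₁ m< = ℤ.<⇒≤ (ℤ.≤-<-trans (all (s≤s⁻¹ m<)) (ℤ.≰⇒> nle))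
  ... | inj₂ refl = ℤ.≤-refl

firstMax-unique : ∀ {g N k l} → FirstMax g N k → FirstMax g N l → k ≡ l
firstMax-unique {k = k} {l} (k≤N , k-before , k-all) (l≤N , l-before , l-all) with <-cmp k l
... | tri< k<l _ _ = ⊥-elim (ℤ.<⇒≱ (l-before k<l) (k-all l≤N))
... | tri≈ _ eq _  = eq
... | tri> _ _ l<k = ⊥-elim (ℤ.<⇒≱ (k-before l<k) (l-all k≤N))

First : (ℕ → Set) → ℕ → Set
First P k = P k × (∀ {m} → m < k → ¬ P m)

first-unique : ∀ {P k l} → First P k → First P l → k ≡ l
first-unique {k = k} {l} (Pk , ¬<k) (Pl , ¬<l) with <-cmp k l
... | tri< k<l _ _ = ⊥-elim (¬<l k<l Pk)
... | tri≈ _ eq _  = eq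
... | tri> _ _ l<k = ⊥-elim (¬<k l<k Pl)

-- Periodic words, and legality in terms of excess

module Periodic (p a : ℕ) .{{p≢0 : NonZero p}} where

  1≤p : 1 ≤ p
  1≤p = ℕ.>-nonZero⁻¹ p

  -- With p = a + b and gcd a b = 1 a factor is zero-sum iff its length is q p and it has q a letters −b.
  Legal : Seq → ℕ → Set
  Legal f N = ∀ i q → i +[ p ] q < N → count f (i +[ p ] q) ≡ count f i +[ a ] q →
    f i ≡ plusA → f (i +[ p ] q) ≡ minusB → ⊥

  ZeroWindow : Seq → ℕ → Set
  ZeroWindow f m = count f (m + p) ≡ count f m + a

  record Loop (c : Seq) : Set where
    field
      periodic : ∀ m → c (m + p) ≡ c m
      total    : count c p ≡ a

    -- Moving a window of a periodic word on by one place trades a letter for an equal one, so every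
    -- window has as many -b as the first.
    gain : ∀ m → count c (m + p) ≡ count c m + a
    gain zero    = total
    gain (suc m) = count-suc-cong {c} {c} (periodic m) (gain m)

    periodic* : ∀ m q → c (m +[ p ] q) ≡ c m
    periodic* m zero    = refl
    periodic* m (suc q) = trans (periodic (m +[ p ] q)) (periodic* m q)

    gain+[] : ∀ m q → count c (m +[ p ] q) ≡ count c m +[ a ] q
    gain+[] m zero    = refl
    gain+[] m (suc q) = trans (gain (m +[ p ] q)) (cong (_+ a) (gain+[] m q))

    gain* : ∀ m q → count c (m +[ p ] q) ≡ count c m + q * a
    gain* m q = trans (gain+[] m q) (+[]≡+* (count c m) a q)

  open Loop

  -- Legal f N, with its count condition read as: the excess over the loop c is the same at both places.
  LegalRelTo : Seq → Seq → ℕ → Set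
  LegalRelTo c f N = ∀ i q → i +[ p ] q < N → excess f c (i +[ p ] q) ≡ excess f c i →
    f i ≡ plusA → f (i +[ p ] q) ≡ minusB → ⊥

  -- Over q p places the loop gains q a letters -b, which is just what `Legal` asks of f.
  legal⇒relTo : ∀ {c f N} → Loop c → Legal f N → LegalRelTo c f N
  legal⇒relTo {c} {f} loop legal i q j<N eq = legal i q j<N
    (trans (excess-≡⁻¹ f c i (i +[ p ] q) (gain* loop i q) eq) (sym (+[]≡+* (count f i) a q)))

  relTo⇒legal : ∀ {c f N} → Loop c → LegalRelTo c f N → Legal f N
  relTo⇒legal {c} {f} loop legal i q j<N eq = legal i q j<N
    (excess-≡ f c i (i +[ p ] q) (gain* loop i q) (trans eq (+[]≡+* (count f i) a q)))

  residue : ∀ k m → k ≤ m → ∃[ r ] ∃[ q ] (r < p × m ≡ (k + r) +[ p ] q)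
  residue k m k≤m = (m ∸ k) % p , (m ∸ k) / p , m%n<n (m ∸ k) p , (begin
    m                                               ≡⟨ m+[n∸m]≡n k≤m ⟨
    k + (m ∸ k)                                     ≡⟨ cong (λ y → k + y) (m≡m%n+[m/n]*n (m ∸ k) p) ⟩
    k + ((m ∸ k) % p + (m ∸ k) / p * p)             ≡⟨ +-assoc k _ _ ⟨
    k + (m ∸ k) % p + (m ∸ k) / p * p               ≡⟨ +[]≡+* _ p ((m ∸ k) / p) ⟨
    (k + (m ∸ k) % p) +[ p ] ((m ∸ k) / p)          ∎)
    where open ≡-Reasoning

  Follows : Seq → Seq → ℕ → Set
  Follows w c k = ∀ {r} → r < p → w (k + r) ≡ c (k + r)

  excess-follows : ∀ {w c k} → Follows w c k → ∀ {r} → r ≤ p → excess w c (k + r) ≡ excess w c k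
  excess-follows {w} {c} {k} same {zero} r≤p = cong (excess w c) (+-identityʳ k)
  excess-follows {w} {c} {k} same {suc r} r<p = begin
    excess w c (k + suc r)    ≡⟨ cong (excess w c) (+-suc k r) ⟩
    excess w c (suc (k + r))  ≡⟨ excess-suc-same w c (k + r) (same r<p) ⟩
    excess w c (k + r)        ≡⟨ excess-follows {w} {c} {k} same (<⇒≤ r<p) ⟩
    excess w c k              ∎
    where open ≡-Reasoning

  -- Were the excess to exceed its value on the window, then at the first such place the letter −b
  -- would follow a zero-sum factor whose first letter is the congruent letter +a of the window.
  window-is-max : ∀ {w c k M} → Loop c → Follows w c k → Legal w M →
    ∀ {m} → k ≤ m → m ≤ M → excess w c m ℤ.≤ excess w c k
  window-is-max {w} {c} {k} {M} loop same legal {m} k≤m m≤M with m≤n⇒m<n∨m≡n k≤m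
  ... | inj₂ refl = ℤ.≤-refl
  window-is-max {w} {c} {k} {M} loop same legal {suc m} _ m<M | inj₁ k<1+m
    with residue k m (s≤s⁻¹ k<1+m)
  ... | r , q , r<p , refl = excess-suc-≤ w c _
    (window-is-max {w} {c} {k} loop same legal (s≤s⁻¹ k<1+m) (<⇒≤ m<M))
    λ wm cm eq → legal⇒relTo loop legal (k + r) q m<M
      (trans eq (sym (excess-follows {w} {c} {k} same (<⇒≤ r<p))))
      (trans (same r<p) (trans (sym (periodic* loop (k + r) q)) cm)) wm

  -- Insertion of a window

  -- A pointwise relation rather than a function, so that it serves both directions:
  -- `insert-insertion` obtains w from v, `remove-insertion` v from w.
  record Insertion (k : ℕ) (c v : Seq) (N : ℕ) (w : Seq) : Set where
    field
      k≤N    : k ≤ N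
      before : ∀ {m} → m < k → w m ≡ v m
      window : Follows w c k
      after  : ∀ {m} → k ≤ m → m < N → w (m + p) ≡ v m

    excess-before : ∀ {m} → m ≤ k → excess w c m ≡ excess v c m
    excess-before {m} m≤k = cong (_⊖ count c m) (count-cong m λ t<m → before (<-≤-trans t<m m≤k))

    excess-window : ∀ {r} → r ≤ p → excess w c (k + r) ≡ excess v c k
    excess-window r≤p = trans (excess-follows {w} {c} window r≤p) (excess-before ≤-refl)

    module _ (loop : Loop c) where

      -- The window leaves the excess unchanged, and behind it each letter of v meets the same
      -- letter of c as before the shift by p, c being periodic.
      excess-after : ∀ {m} → k ≤ m → m ≤ N → excess w c (m + p) ≡ excess v c m
      excess-after {m} k≤m m≤N with m≤n⇒m<n∨m≡n k≤m
      ... | inj₂ refl = excess-window ≤-refl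
      excess-after {suc m} _ m<N | inj₁ (s≤s k≤m) =
        excess-suc-cong {w} {v} {c} {c} (after k≤m m<N) (periodic loop m) (excess-after k≤m (<⇒≤ m<N))

      zeroWindow : ZeroWindow w k
      zeroWindow = excess-≡⁻¹ w c k (k + p) (gain loop k) (trans (excess-window ≤-refl) (sym (excess-before ≤-refl)))

      count-total : count w (N + p) ≡ count v N + a
      count-total = go k≤N ≤-refl
        where
        go : ∀ {m} → k ≤ m → m ≤ N → count w (m + p) ≡ count v m + a
        go {m} k≤m m≤N with m≤n⇒m<n∨m≡n k≤m
        ... | inj₂ refl = trans zeroWindow (cong (_+ a) (count-cong k before))
        go {suc m} _ m<N | inj₁ (s≤s k≤m) = count-suc-cong {w} {v} (after k≤m m<N) (go k≤m (<⇒≤ m<N))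

  data Place (k : ℕ) : ℕ → Set where
    before-window : ∀ {m} → m < k → Place k m
    in-window     : ∀ {r} → r < p → Place k (k + r)
    after-window  : ∀ {m} → k ≤ m → Place k (m + p)

  place : ∀ k m → Place k m
  place k m with m <? k
  ... | yes m<k = before-window m<k
  ... | no  m≮k with (m ∸ k) <? p
  ...   | yes lt = subst (Place k) (m+[n∸m]≡n (≮⇒≥ m≮k)) (in-window lt)
  ...   | no nlt = subst (Place k) (m∸n+n≡m p≤m) (after-window (+-cancelʳ-≤ p k (m ∸ p) le))
    where
    k+p≤m : k + p ≤ m
    k+p≤m = ≤-trans (+-monoʳ-≤ k (≮⇒≥ nlt)) (≤-reflexive (m+[n∸m]≡n (≮⇒≥ m≮k)))
    p≤m : p ≤ m
    p≤m = ≤-trans (m≤n+m p k) k+p≤m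
    le : k + p ≤ m ∸ p + p
    le = ≤-trans k+p≤m (≤-reflexive (sym (m∸n+n≡m p≤m)))

  -- Legality under removal and insertion

  legalRelTo-at : ∀ {c f N} → LegalRelTo c f N → ∀ i q {j} → i +[ p ] q ≡ j → j < N →
    excess f c j ≡ excess f c i → f i ≡ plusA → f j ≡ minusB → ⊥
  legalRelTo-at legal i q refl = legal i q

  -- A forbidden pair of v, a +a and the later -b, stays forbidden in w: the insertion does not
  -- affect the excesses, and the distance is unchanged or, if the window comes between the two
  -- letters, grows by p.
  legal-remove : ∀ {k c v N w} → Loop c → Insertion k c v N w → Legal w (N + p) → Legal v N
  legal-remove {k} {c} {v} {N} {w} loop I legal = relTo⇒legal loop go
    where
    open Insertion I
    illegal : ∀ i q {j} → i +[ p ] q ≡ j → j < N + p →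
      excess w c j ≡ excess w c i → w i ≡ plusA → w j ≡ minusB → ⊥
    illegal = legalRelTo-at {c} {w} (legal⇒relTo loop legal)
    go : LegalRelTo c v N
    go i q j<N eq vi vj with i <? k | i +[ p ] q <? k
    ... | yes i<k | yes j<k = illegal i q refl (<-≤-trans j<N (m≤m+n N p))
      (trans (excess-before (<⇒≤ j<k)) (trans eq (sym (excess-before (<⇒≤ i<k)))))
      (trans (before i<k) vi) (trans (before j<k) vj)
    ... | yes i<k | no j≮k = illegal i (suc q) refl (+-monoˡ-< p j<N)
      (trans (excess-after loop (≮⇒≥ j≮k) (<⇒≤ j<N)) (trans eq (sym (excess-before (<⇒≤ i<k)))))
      (trans (before i<k) vi) (trans (after (≮⇒≥ j≮k) j<N) vj)
    ... | no i≮k | _ = illegal (i + p) q (+[]-shift i p q) (+-monoˡ-< p j<N)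
      (trans (excess-after loop k≤j (<⇒≤ j<N)) (trans eq (sym (excess-after loop k≤i (<⇒≤ i<N)))))
      (trans (after k≤i i<N) vi) (trans (after k≤j j<N) vj)
      where
      k≤i : k ≤ i
      k≤i = ≮⇒≥ i≮k
      k≤j : k ≤ i +[ p ] q
      k≤j = ≤-trans k≤i (x≤x+[] i p q)
      i<N : i < N
      i<N = ≤-<-trans (x≤x+[] i p q) j<N

  plusA≢minusB : ∀ {x} → x ≡ plusA → x ≡ minusB → ⊥
  plusA≢minusB refl ()

  excess-in-window : ∀ {k c v N w} → Insertion k c v N w → ∀ {m} → k ≤ m → m ≤ k + p → excess w c m ≡ excess v c k
  excess-in-window {k} {c} {v} {N} {w} I {m} k≤m m≤k+p =
    trans (cong (excess w c) (sym (m+[n∸m]≡n k≤m)))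
      (Insertion.excess-window I (+-cancelˡ-≤ k (m ∸ k) p (≤-trans (≤-reflexive (m+[n∸m]≡n k≤m)) m≤k+p)))

  -- Forbidden pairs with both letters from v already occur in v. In the others exactly one letter
  -- belongs to the window, and the choice of k as first maximum excludes them.
  legal-insert : ∀ {k c v N w} → Loop c → Insertion k c v N w → FirstMax (excess v c) N k →
    Legal v N → Legal w (N + p)
  legal-insert {k} {c} {v} {N} {w} loop I (_ , max-before , max-all) legal = relTo⇒legal loop go
    where
    open Insertion I
    illegal : ∀ i q {j} → i +[ p ] q ≡ j → j < N →
      excess v c j ≡ excess v c i → v i ≡ plusA → v j ≡ minusB → ⊥
    illegal = legalRelTo-at {c} {v} (legal⇒relTo loop legal)
    go : LegalRelTo c w (N + p)
    go i zero _ _ wi wj = plusA≢minusB wi wj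
    go i (suc q) j<M eq wi wj with place k i
    ... | before-window i<k with i +[ p ] q <? k | (i +[ p ] q) + p <? k
    ...   | no j≮k | _ = illegal i q refl j<N
      (trans (sym (excess-after loop (≮⇒≥ j≮k) (<⇒≤ j<N))) (trans eq (excess-before (<⇒≤ i<k))))
      (trans (sym (before i<k)) wi) (trans (sym (after (≮⇒≥ j≮k) j<N)) wj)
      where
      j<N : i +[ p ] q < N
      j<N = +-cancelʳ-< p _ N j<M
    ...   | yes _ | yes j<k = illegal i (suc q) refl (<-≤-trans j<k k≤N)
      (trans (sym (excess-before (<⇒≤ j<k))) (trans eq (excess-before (<⇒≤ i<k))))
      (trans (sym (before i<k)) wi) (trans (sym (before j<k)) wj)
    -- The -b lies in the window, where the excess is the maximum, but the +a lies before k, where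
    -- it is strictly smaller.
    ...   | yes j<k | no j≮k = ℤ.<-irrefl
      (trans (sym (excess-before (<⇒≤ i<k))) (trans (sym eq) (excess-in-window I (≮⇒≥ j≮k) (+-monoˡ-≤ p (<⇒≤ j<k)))))
      (max-before i<k)
    -- The +a lies in the window. At the place j of v the excess is then maximal, c has +a by
    -- periodicity and v has -b, so at j + 1 the excess would surpass the maximum.
    go .(k + _) (suc q) j<M eq wi wj | in-window {r} r<p = ℤ.<⇒≱
      (excess-suc-up v c j (trans (sym (after k≤j j<N)) wj)
        (trans (periodic* loop (k + r) q) (trans (sym (window r<p)) wi)))
      (ℤ.≤-trans (max-all j<N) (ℤ.≤-reflexive
        (trans (sym (excess-window (<⇒≤ r<p))) (trans (sym eq) (excess-after loop k≤j (<⇒≤ j<N))))))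
      where
      j : ℕ
      j = (k + r) +[ p ] q
      k≤j : k ≤ j
      k≤j = ≤-trans (m≤m+n k r) (x≤x+[] (k + r) p q)
      j<N : j < N
      j<N = +-cancelʳ-< p j N j<M
    go .(_ + p) (suc q) j<M eq wi wj | after-window {i} k≤i = illegal i (suc q) (sym (+[]-shift i p q)) j<N
      (trans (sym (excess-after loop k≤j (<⇒≤ j<N))) (trans eq (excess-after loop k≤i (<⇒≤ i<N))))
      (trans (sym (after k≤i i<N)) wi) (trans (sym (after k≤j j<N)) wj)
      where
      j : ℕ
      j = (i + p) +[ p ] q
      i≤j : i ≤ j
      i≤j = ≤-trans (m≤m+n i p) (x≤x+[] (i + p) p q)
      k≤j : k ≤ j
      k≤j = ≤-trans k≤i i≤j
      j<N : j < N
      j<N = +-cancelʳ-< p j N j<M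
      i<N : i < N
      i<N = ≤-<-trans i≤j j<N

  -- Periodic extension of a window

  -- This is (m - k) mod p, with - k replaced by k (p - 1) to keep clear of truncated subtraction.
  align : ℕ → ℕ → ℕ
  align k m = (m + k * pred p) % p

  align<p : ∀ k m → align k m < p
  align<p k m = m%n<n _ p

  k+k*pred[p] : ∀ k → k + k * pred p ≡ k * p
  k+k*pred[p] k = trans (sym (*-suc k (pred p))) (cong (k *_) (suc-pred p))

  align-window : ∀ k {r} → r < p → align k (k + r) ≡ r
  align-window k {r} r<p = begin
    (k + r + k * pred p) % p    ≡⟨ cong (λ x → (x + k * pred p) % p) (+-comm k r) ⟩
    (r + k + k * pred p) % p    ≡⟨ cong (_% p) (+-assoc r k _) ⟩
    (r + (k + k * pred p)) % p  ≡⟨ cong (λ x → (r + x) % p) (k+k*pred[p] k) ⟩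
    (r + k * p) % p             ≡⟨ [m+kn]%n≡m%n r k p ⟩
    r % p                       ≡⟨ m<n⇒m%n≡m r<p ⟩
    r                           ∎
    where open ≡-Reasoning

  %-absorbˡ : ∀ m n → (m % p + n) % p ≡ (m + n) % p
  %-absorbˡ m n = begin
    (m % p + n) % p          ≡⟨ %-distribˡ-+ (m % p) n p ⟩
    (m % p % p + n % p) % p  ≡⟨ cong (λ x → (x + n % p) % p) (m%n%n≡m%n m p) ⟩
    (m % p + n % p) % p      ≡⟨ %-distribˡ-+ m n p ⟨
    (m + n) % p              ∎
    where open ≡-Reasoning

  align-% : ∀ k m → align k (m % p) ≡ align k m
  align-% k m = %-absorbˡ m (k * pred p)

  k+align-% : ∀ k m → (k + align k m) % p ≡ m % p
  k+align-% k m = begin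
    (k + align k m) % p           ≡⟨ cong (_% p) (+-comm k _) ⟩
    (align k m + k) % p           ≡⟨ %-absorbˡ (m + k * pred p) k ⟩
    (m + k * pred p + k) % p      ≡⟨ cong (_% p) (+-assoc m _ k) ⟩
    (m + (k * pred p + k)) % p    ≡⟨ cong (λ x → (m + x) % p) (trans (+-comm _ k) (k+k*pred[p] k)) ⟩
    (m + k * p) % p               ≡⟨ [m+kn]%n≡m%n m k p ⟩
    m % p                         ∎
    where open ≡-Reasoning

  -- Continues the window of w at k periodically in both directions: each place reads the congruent
  -- place of the window.
  extend : ℕ → Seq → Seq
  extend k w m = w (k + align k m)

  extend-follows : ∀ k w → Follows w (extend k w) k
  extend-follows k w r<p = cong (λ x → w (k + x)) (sym (align-window k r<p))

  count-periodic : ∀ {c} → (∀ m → c (m + p) ≡ c m) → ∀ m → count c (m + p) ≡ count c m + count c p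
  count-periodic per zero = refl
  count-periodic {c} per (suc m) = count-suc-cong {c} {c} (per m) (count-periodic per m)

  -- `total` concerns the first p places, the hypothesis the window at k. All windows of a periodic
  -- word have equally many -b, and on the window at k the extension coincides with w.
  extend-loop : ∀ {k w} → ZeroWindow w k → Loop (extend k w)
  extend-loop {k} {w} zw = record
    { periodic = per
    ; total    = +-cancelˡ-≡ (count w k) _ _ (trans (sym gained) zw)
    }
    where
    c : Seq
    c = extend k w
    per : ∀ m → c (m + p) ≡ c m
    per m = cong (λ x → w (k + x)) (trans (sym (align-% k (m + p)))
      (trans (cong (align k) ([m+n]%n≡m%n m p)) (align-% k m)))
    gained : count w (k + p) ≡ count w k + count c p
    gained = excess-≡⁻¹ w c k (k + p) (count-periodic {c} per k)
      (excess-follows {w} {c} {k} (extend-follows k w) ≤-refl)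

  -- Position of the first zero-sum window

  -- An earlier zero-sum window would produce, before k, an excess at least as large as at k.
  first-insert : ∀ {k c v N w} → Loop c → Insertion k c v N w → FirstMax (excess v c) N k →
    Legal v N → First (ZeroWindow w) k
  first-insert {k} {c} {v} {N} {w} loop I (_ , max-before , _) legal = zeroWindow loop , none
    where
    open Insertion I
    none : ∀ {m} → m < k → ¬ ZeroWindow w m
    none {m} m<k zw with m + p <? k
    -- The window at m ends within the inserted one, so the excess at m equals the maximum.
    ... | no m+p≮k = ℤ.<-irrefl
      (trans (sym (excess-before (<⇒≤ m<k))) (trans (sym (excess-≡ w c m (m + p) (gain loop m) zw))
        (excess-in-window I (≮⇒≥ m+p≮k) (+-monoˡ-≤ p (<⇒≤ m<k)))))
      (max-before m<k)
    -- The window at m lies in v. Over its own extension `c₀` the excess at k is at most that at the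
    -- congruent place m + r of the window. Between congruent places all loops gain alike, so the
    -- inequality carries over to c.
    ... | yes m+p<k with residue m k (<⇒≤ m<k)
    ...   | r , q , r<p , k≡ = ℤ.<⇒≱ (max-before m+r<k)
      (subst (λ x → excess v c x ℤ.≤ excess v c (m + r)) (sym k≡)
        (excess-≤ v c (m + r) ((m + r) +[ p ] q) (gain* loop (m + r) q)
          (excess-≤⁻¹ v c₀ (m + r) ((m + r) +[ p ] q) (gain* loop₀ (m + r) q) below)))
      where
      m+r<k : m + r < k
      m+r<k = <-trans (+-monoʳ-< m r<p) m+p<k
      zw-v : ZeroWindow v m
      zw-v = trans (count-cong (m + p) (λ t< → sym (before (<-trans t< m+p<k))))
        (trans zw (cong (_+ a) (count-cong m λ t< → before (<-trans t< m<k))))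
      c₀ : Seq
      c₀ = extend m v
      loop₀ : Loop c₀
      loop₀ = extend-loop {m} {v} zw-v
      below : excess v c₀ ((m + r) +[ p ] q) ℤ.≤ excess v c₀ (m + r)
      below = subst₂ (λ x y → excess v c₀ x ℤ.≤ y) k≡
        (sym (excess-follows {v} {c₀} {m} (extend-follows m v) (<⇒≤ r<p)))
        (window-is-max {v} {c₀} {m} loop₀ (extend-follows m v) legal (<⇒≤ m<k) k≤N)

  -- Windows of constant sign, and existence of a zero-sum window

  Rising Falling : Seq → ℕ → Set
  Rising  f m = count f m + a < count f (m + p)
  Falling f m = count f (m + p) < count f m + a

  -- A discrete intermediate value argument: one step changes the number of -b in the window by at
  -- most 1, so the sign cannot change without passing a zero-sum window.
  rising-suc : ∀ f m → ¬ ZeroWindow f (suc m) → Rising f m → Rising f (suc m)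
  rising-suc f m ¬zw rising = ≤∧≢⇒< (≤-trans (+-monoˡ-≤ a (count-suc≤ f m))
    (≤-trans rising (count-suc≥ f (m + p)))) (¬zw ∘ sym)

  falling-suc : ∀ f m → ¬ ZeroWindow f (suc m) → Falling f m → Falling f (suc m)
  falling-suc f m ¬zw falling = ≤∧≢⇒< (≤-trans (count-suc≤ f (m + p))
    (≤-trans falling (+-monoˡ-≤ a (count-suc≥ f m)))) ¬zw

  constant-sign : ∀ f K → (∀ {m} → m < K → ¬ ZeroWindow f m) →
    (∀ {m} → m < K → Rising f m) ⊎ (∀ {m} → m < K → Falling f m)
  constant-sign f zero    ¬zw = inj₁ λ ()
  constant-sign f (suc K) ¬zw with <-cmp (count f p) a
  ... | tri< lt _ _ = inj₂ go
    where
    go : ∀ {m} → m < suc K → Falling f m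
    go {zero}  _   = lt
    go {suc m} m<K = falling-suc f m (¬zw m<K) (go (<-trans (n<1+n m) m<K))
  ... | tri≈ _ eq _ = ⊥-elim (¬zw (s≤s z≤n) eq)
  ... | tri> _ _ gt = inj₁ go
    where
    go : ∀ {m} → m < suc K → Rising f m
    go {zero}  _   = gt
    go {suc m} m<K = rising-suc f m (¬zw m<K) (go (<-trans (n<1+n m) m<K))

  -- Jumps of length p that start before k cannot leap over the flat stretch from k to k + p. The
  -- relation R is a parameter so as to serve both ascent and descent.
  climb : ∀ {R : ℤ → ℤ → Set} → Transitive R → (g : ℕ → ℤ) → ∀ {k} →
    (∀ {m} → k ≤ m → m ≤ k + p → g m ≡ g k) → (∀ {m} → m < k → R (g m) (g (m + p))) →
    ∀ {m} → m < k → R (g m) (g k)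
  climb {R} R-trans g {k} flat step {m} m<k = go k m (m≤n+m k m) m<k
    where
    -- `d` bounds the remaining distance to k and makes the recursion structural; each jump advances
    -- by p ≥ 1.
    go : ∀ d m → k ≤ m + d → m < k → R (g m) (g k)
    go d m k≤m+d m<k with m + p <? k
    ... | no m+p≮k = subst (R (g m)) (flat (≮⇒≥ m+p≮k) (+-monoˡ-≤ p (<⇒≤ m<k))) (step m<k)
    go zero    m k≤m+d m<k | yes m+p<k = ⊥-elim (<⇒≱ m<k (≤-trans k≤m+d (≤-reflexive (+-identityʳ m))))
    go (suc d) m k≤m+d m<k | yes m+p<k = R-trans (step m<k) (go d (m + p) k≤ m+p<k)
      where
      k≤ : k ≤ m + p + d
      k≤ = ≤-trans k≤m+d (≤-trans (≤-reflexive (sym (+-assoc m 1 d))) (+-monoˡ-≤ d (+-monoʳ-≤ m 1≤p)))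

  -- From the window on, `window-is-max` applies. Before it all windows of length p have the same
  -- sign; if they are rising, jumps of length p lead strictly upwards into the window.
  firstMax-remove : ∀ {k c v N w} → Loop c → Insertion k c v N w → Legal w (N + p) →
    (∀ {m} → m < k → ¬ ZeroWindow w m) → excess w c (N + p) ≡ 0ℤ → FirstMax (excess v c) N k
  firstMax-remove {k} {c} {v} {N} {w} loop I legal ¬zw end = k≤N , max-before , max-all
    where
    open Insertion I
    later : ∀ {m} → k ≤ m → m ≤ N + p → excess w c m ℤ.≤ excess w c k
    later = window-is-max {w} {c} {k} loop window legal
    flat : ∀ {m} → k ≤ m → m ≤ k + p → excess w c m ≡ excess w c k
    flat k≤m m≤ = trans (excess-in-window I k≤m m≤) (sym (excess-before ≤-refl))
    max-before : ∀ {m} → m < k → excess v c m ℤ.< excess v c k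
    max-before {m} m<k = subst₂ ℤ._<_ (excess-before (<⇒≤ m<k)) (excess-before ≤-refl) (go (constant-sign w k ¬zw))
      where
      go : (∀ {m} → m < k → Rising w m) ⊎ (∀ {m} → m < k → Falling w m) → excess w c m ℤ.< excess w c k
      go (inj₁ rising) = climb {R = ℤ._<_} ℤ.<-trans (excess w c) flat
        (λ {m} m<k → excess-> w c m (m + p) (gain loop m) (rising m<k)) m<k
      -- The excess is 0 at both ends, so it cannot be negative from the window on.
      go (inj₂ falling) = ⊥-elim (ℤ.<⇒≱
        (climb {R = λ x y → y ℤ.< x} (λ {x} {y} {z} x>y y>z → ℤ.<-trans {z} {y} {x} y>z x>y) (excess w c) flat
          (λ {m} m<k → excess-< w c m (m + p) (gain loop m) (falling m<k)) {0} (≤-<-trans z≤n m<k))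
        (subst (ℤ._≤ excess w c k) end (later (≤-trans k≤N (m≤m+n N p)) ≤-refl)))
    max-all : ∀ {m} → m ≤ N → excess v c m ℤ.≤ excess v c k
    max-all {m} m≤N with m <? k
    ... | yes m<k = ℤ.<⇒≤ (max-before m<k)
    ... | no  m≮k = subst₂ ℤ._≤_ (excess-after loop (≮⇒≥ m≮k) m≤N) (excess-before ≤-refl)
      (later (≤-trans (≮⇒≥ m≮k) (m≤m+n m p)) (+-monoˡ-≤ p m≤N))

  search : ∀ f K → (∃[ k ] k < K × First (ZeroWindow f) k) ⊎ (∀ {m} → m < K → ¬ ZeroWindow f m)
  search f zero = inj₂ λ ()
  search f (suc K) with search f K
  ... | inj₁ (k , k<K , first) = inj₁ (k , ≤-trans k<K (n≤1+n K) , first)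
  ... | inj₂ none with count f (K + p) ≟ count f K + a
  ...   | yes zw = inj₁ (K , ≤-refl , zw , none)
  ...   | no ¬zw = inj₂ none′
    where
    none′ : ∀ {m} → m < suc K → ¬ ZeroWindow f m
    none′ m< with m≤n⇒m<n∨m≡n (s≤s⁻¹ m<)
    ... | inj₁ m<K = none m<K
    ... | inj₂ refl = ¬zw

  -- The windows at 0, p, ..., n p tile the word. If there were no zero-sum window, these would all
  -- be rising or all falling, and the total would differ from (n + 1) a.
  first-zeroWindow : ∀ f n → count f (0 +[ p ] suc n) ≡ 0 +[ a ] suc n →
    ∃[ k ] k ≤ 0 +[ p ] n × First (ZeroWindow f) k
  first-zeroWindow f n total with search f (suc (0 +[ p ] n))
  ... | inj₁ (k , k<K , first) = k , s≤s⁻¹ k<K , first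
  ... | inj₂ none with constant-sign f _ none
  ...   | inj₁ rising = ⊥-elim (<-irrefl (sym total) (go n ≤-refl))
    where
    go : ∀ q → 0 +[ p ] q < suc (0 +[ p ] n) → 0 +[ a ] suc q < count f (0 +[ p ] suc q)
    go zero    q< = rising q<
    go (suc q) q< = <-trans (+-monoˡ-< a (go q (≤-<-trans (m≤m+n _ p) q<))) (rising q<)
  ...   | inj₂ falling = ⊥-elim (<-irrefl total (go n ≤-refl))
    where
    go : ∀ q → 0 +[ p ] q < suc (0 +[ p ] n) → count f (0 +[ p ] suc q) < 0 +[ a ] suc q
    go zero    q< = falling q<
    go (suc q) q< = <-trans (falling q<) (+-monoˡ-< a (go q (≤-<-trans (m≤m+n _ p) q<)))

-- Words as finite sequences

-- Positions beyond the end hold the junk letter +a.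
at : ∀ {N} → Vec Letter N → Seq
at []      _       = plusA
at (x ∷ w) zero    = x
at (x ∷ w) (suc m) = at w m

tab : ∀ N → Seq → Vec Letter N
tab zero    f = []
tab (suc N) f = f 0 ∷ tab N (f ∘ suc)

at-tab : ∀ {N} f {m} → m < N → at (tab N f) m ≡ f m
at-tab {suc N} f {zero}  _         = refl
at-tab {suc N} f {suc m} (s≤s m<N) = at-tab (f ∘ suc) m<N

at-injective : ∀ {N} {v w : Vec Letter N} → (∀ {m} → m < N → at v m ≡ at w m) → v ≡ w
at-injective {v = []}    {[]}    eq = refl
at-injective {v = x ∷ v} {y ∷ w} eq = cong₂ _∷_ (eq (s≤s z≤n)) (at-injective (eq ∘ s≤s))

at-lookup : ∀ {N} (w : Vec Letter N) i → at w (toℕ i) ≡ lookup w i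
at-lookup (x ∷ w) Fin.zero    = refl
at-lookup (x ∷ w) (Fin.suc i) = at-lookup w i

downsᵛ : ∀ {N} → Vec Letter N → ℕ
downsᵛ []      = 0
downsᵛ (x ∷ w) = downs x + downsᵛ w

-- `count` peels letters off the end, vectors off the front; this reconciles the two.
count-uncons : ∀ f m → count f (suc m) ≡ downs (f 0) + count (f ∘ suc) m
count-uncons f zero    = refl
count-uncons f (suc m) = begin
  downs (f (suc m)) + count f (suc m)                        ≡⟨ cong (downs (f (suc m)) +_) (count-uncons f m) ⟩
  downs (f (suc m)) + (downs (f 0) + count (f ∘ suc) m)      ≡⟨ +-assoc (downs (f (suc m))) _ _ ⟨
  downs (f (suc m)) + downs (f 0) + count (f ∘ suc) m
    ≡⟨ cong (_+ count (f ∘ suc) m) (+-comm (downs (f (suc m))) _) ⟩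
  downs (f 0) + downs (f (suc m)) + count (f ∘ suc) m        ≡⟨ +-assoc (downs (f 0)) _ _ ⟩
  downs (f 0) + count (f ∘ suc) (suc m)                      ∎
  where open ≡-Reasoning

count-at : ∀ {N} (w : Vec Letter N) → count (at w) N ≡ downsᵛ w
count-at []              = refl
count-at {suc N} (x ∷ w) = trans (count-uncons (at (x ∷ w)) N) (cong (downs x +_) (count-at w))

-- Words with a given number of -b

Combination : ℕ → ℕ → Set
Combination N k = Σ (Vec Letter N) λ w → downsᵛ w ≡ k

combination-≡ : ∀ {N k} {u v : Combination N k} → proj₁ u ≡ proj₁ v → u ≡ v
combination-≡ {u = w , e} {.w , e′} refl = cong (w ,_) (ℕₚ.≡-irrelevant e e′)

combination-suc-zero : ∀ N → Combination (suc N) 0 ↔ Combination N 0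
combination-suc-zero N = mk↔ₛ′ to (λ (w , e) → plusA ∷ w , e) (λ _ → refl) from∘to
  where
  to : Combination (suc N) 0 → Combination N 0
  to (plusA ∷ w , e) = w , e
  from∘to : ∀ u → (plusA ∷ proj₁ (to u) , proj₂ (to u)) ≡ u
  from∘to (plusA ∷ w , e) = refl

-- Pascal's rule, by the first letter.
combination-suc-suc : ∀ N k → Combination (suc N) (suc k) ↔ (Combination N k ⊎ Combination N (suc k))
combination-suc-suc N k = mk↔ₛ′ to from to∘from from∘to
  where
  to : Combination (suc N) (suc k) → Combination N k ⊎ Combination N (suc k)
  to (plusA  ∷ w , e) = inj₂ (w , e)
  to (minusB ∷ w , e) = inj₁ (w , cong pred e)
  from : Combination N k ⊎ Combination N (suc k) → Combination (suc N) (suc k)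
  from (inj₁ (w , e)) = minusB ∷ w , cong suc e
  from (inj₂ (w , e)) = plusA ∷ w , e
  to∘from : ∀ u → to (from u) ≡ u
  to∘from (inj₁ _) = cong inj₁ (combination-≡ refl)
  to∘from (inj₂ _) = refl
  from∘to : ∀ u → from (to u) ≡ u
  from∘to (plusA  ∷ w , e) = refl
  from∘to (minusB ∷ w , e) = combination-≡ refl

nC0≡1 : ∀ n → n C 0 ≡ 1
nC0≡1 n = trans (nCk≡nC[n∸k] {n = n} z≤n) (nCn≡1 n)

-- For N = a + b and k = a these are the zero-sum words of one period: a letters -b against b
-- letters +a.
combination↔ : ∀ N k → Combination N k ↔ Fin (N C k)
combination↔ zero zero = mk↔ₛ′ (λ _ → Fin.zero) (λ _ → [] , refl)
  (λ { Fin.zero → refl ; (Fin.suc ()) }) (λ { ([] , refl) → refl })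
combination↔ zero (suc k) = mk↔ₛ′ (λ { ([] , ()) }) (λ ()) (λ ()) (λ { ([] , ()) })
combination↔ (suc N) zero = ↔-trans (combination-suc-zero N) (↔-trans (combination↔ N zero)
  (≡⇒↔ (trans (nC0≡1 N) (sym (nC0≡1 (suc N))))))
  where
  ≡⇒↔ : ∀ {m n} → m ≡ n → Fin m ↔ Fin n
  ≡⇒↔ refl = ↔-refl
combination↔ (suc N) (suc k) = subst (λ x → Combination (suc N) (suc k) ↔ Fin x) (nCk+nC[k+1]≡[n+1]C[k+1] N k)
  (↔-trans (combination-suc-suc N k) (↔-trans (combination↔ N k ⊎-↔ combination↔ N (suc k)) (↔-sym +↔⊎)))

-- The bijection and the count of legal words

module Bijection (p a : ℕ) .{{p≢0 : NonZero p}} where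

  open Periodic p a
  open Loop
  open Insertion

  LegalWord : ℕ → Set
  LegalWord n = Σ (Vec Letter (0 +[ p ] n)) λ w →
    count (at w) (0 +[ p ] n) ≡ 0 +[ a ] n × Legal (at w) (0 +[ p ] n)

  legalWord-≡ : ∀ {n} {u v : LegalWord n} → proj₁ u ≡ proj₁ v → u ≡ v
  -- `l` and `l′` are functions into `⊥`, whose elements are definitionally equal, so only the count
  -- proofs have to be identified.
  legalWord-≡ {u = w , e , l} {.w , e′ , l′} refl = cong (λ x → w , x , l) (ℕₚ.≡-irrelevant e e′)

  -- Anchored at position 0 and not at k: what gets inserted at k is the rotation of ℓ that begins
  -- with its letter at k mod p.
  cycle : Vec Letter p → Seq
  cycle ℓ m = at ℓ (m % p)

  cycle-loop : ∀ ℓ → downsᵛ ℓ ≡ a → Loop (cycle ℓ)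
  cycle-loop ℓ e = record
    { periodic = λ m → cong (at ℓ) ([m+n]%n≡m%n m p)
    ; total    = trans (count-cong p λ t<p → cong (at ℓ) (m<n⇒m%n≡m t<p)) (trans (count-at ℓ) e)
    }

  insert : ℕ → Seq → Seq → Seq
  insert k c v m with m <? k | m <? k + p
  ... | yes _ | _     = v m
  ... | no  _ | yes _ = c m
  ... | no  _ | no  _ = v (m ∸ p)

  remove : ℕ → Seq → Seq
  remove k w m with m <? k
  ... | yes _ = w m
  ... | no  _ = w (m + p)

  insert-insertion : ∀ {k c v N} → k ≤ N → Insertion k c v N (at (tab (N + p) (insert k c v)))
  insert-insertion {k} {c} {v} {N} k≤N = record
    { k≤N    = k≤N
    ; before = λ m<k → trans (at-tab _ (<-≤-trans m<k (≤-trans k≤N (m≤m+n N p)))) (insert-before m<k)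
    ; window = λ r<p → trans (at-tab _ (<-≤-trans (+-monoʳ-< k r<p) (+-monoˡ-≤ p k≤N))) (insert-window r<p)
    ; after  = λ k≤m m<N → trans (at-tab _ (+-monoˡ-< p m<N)) (insert-after k≤m)
    }
    where
    insert-before : ∀ {m} → m < k → insert k c v m ≡ v m
    insert-before {m} m<k with m <? k | m <? k + p
    ... | yes _  | _ = refl
    ... | no m≮k | _ = ⊥-elim (m≮k m<k)
    insert-window : ∀ {r} → r < p → insert k c v (k + r) ≡ c (k + r)
    insert-window {r} r<p with k + r <? k | k + r <? k + p
    ... | yes lt | _     = ⊥-elim (<⇒≱ lt (m≤m+n k r))
    ... | no _   | yes _ = refl
    ... | no _   | no ≮  = ⊥-elim (≮ (+-monoʳ-< k r<p))
    insert-after : ∀ {m} → k ≤ m → insert k c v (m + p) ≡ v m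
    insert-after {m} k≤m with m + p <? k | m + p <? k + p
    ... | yes lt | _      = ⊥-elim (<⇒≱ lt (≤-trans k≤m (m≤m+n m p)))
    ... | no _   | yes lt = ⊥-elim (<⇒≱ lt (+-monoˡ-≤ p k≤m))
    ... | no _   | no _   = cong v (m+n∸n≡m m p)

  -- The period is read off the window by residues modulo p, not from the start of the window, so
  -- that `cycle` puts each letter back in its place.
  remove-insertion : ∀ {k w N} → k ≤ N → Insertion k (cycle (tab p (extend k w))) (at (tab N (remove k w))) N w
  remove-insertion {k} {w} {N} k≤N = record
    { k≤N    = k≤N
    ; before = λ m<k → sym (trans (at-tab _ (<-≤-trans m<k k≤N)) (remove-before m<k))
    ; window = λ {r} r<p → trans (extend-follows k w r<p) (sym (trans (at-tab _ (m%n<n (k + r) p))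
        (cong (λ x → w (k + x)) (align-% k (k + r)))))
    ; after  = λ k≤m m<N → sym (trans (at-tab _ m<N) (remove-after k≤m))
    }
    where
    remove-before : ∀ {m} → m < k → remove k w m ≡ w m
    remove-before {m} m<k with m <? k
    ... | yes _  = refl
    ... | no m≮k = ⊥-elim (m≮k m<k)
    remove-after : ∀ {m} → k ≤ m → remove k w m ≡ w (m + p)
    remove-after {m} k≤m with m <? k
    ... | yes lt = ⊥-elim (<⇒≱ lt k≤m)
    ... | no _   = refl

  insertion-functional : ∀ {k c v N w w′} → Insertion k c v N w → Insertion k c v N w′ →
    ∀ {m} → m < N + p → w m ≡ w′ m
  insertion-functional {k} {N = N} I I′ {m} m<M with place k m
  ... | before-window m<k = trans (before I m<k) (sym (before I′ m<k))
  ... | in-window r<p = trans (window I r<p) (sym (window I′ r<p))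
  ... | after-window {i} k≤i = trans (after I k≤i i<N) (sym (after I′ k≤i i<N))
    where
    i<N : i < N
    i<N = +-cancelʳ-< p i N m<M

  insertion-injective-word : ∀ {k c c′ v v′ N w} → Insertion k c v N w → Insertion k c′ v′ N w →
    ∀ {m} → m < N → v m ≡ v′ m
  insertion-injective-word {k} I I′ {m} m<N with m <? k
  ... | yes m<k = trans (sym (before I m<k)) (before I′ m<k)
  ... | no  m≮k = trans (sym (after I (≮⇒≥ m≮k) m<N)) (after I′ (≮⇒≥ m≮k) m<N)

  -- The window at k meets every residue modulo p, the residue m at k + `align k m`, and so shows
  -- every letter of the period.
  insertion-injective-cycle : ∀ {k ℓ ℓ′ v v′ N w} → Insertion k (cycle ℓ) v N w → Insertion k (cycle ℓ′) v′ N w →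
    ∀ {m} → m < p → at ℓ m ≡ at ℓ′ m
  insertion-injective-cycle {k} {ℓ} {ℓ′} {w = w} I I′ {m} m<p = begin
    at ℓ m                        ≡⟨ cong (at ℓ) residue-m ⟨
    cycle ℓ (k + align k m)       ≡⟨ window I (align<p k m) ⟨
    w (k + align k m)             ≡⟨ window I′ (align<p k m) ⟩
    cycle ℓ′ (k + align k m)      ≡⟨ cong (at ℓ′) residue-m ⟩
    at ℓ′ m                       ∎
    where
    open ≡-Reasoning
    residue-m : (k + align k m) % p ≡ m
    residue-m = trans (k+align-% k m) (m<n⇒m%n≡m m<p)

  module _ {n : ℕ} where

    private
      N : ℕ
      N = 0 +[ p ] n

    module Glue (ℓ : Vec Letter p) (e : downsᵛ ℓ ≡ a) (v : Vec Letter N)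
      (total-v : count (at v) N ≡ 0 +[ a ] n) (legal-v : Legal (at v) N) where

      loop : Loop (cycle ℓ)
      loop = cycle-loop ℓ e
      max : ∃ (FirstMax (excess (at v) (cycle ℓ)) N)
      max = firstMax _ N
      k : ℕ
      k = proj₁ max
      word : Vec Letter (N + p)
      word = tab (N + p) (insert k (cycle ℓ) (at v))
      insertion : Insertion k (cycle ℓ) (at v) N (at word)
      insertion = insert-insertion (proj₁ (proj₂ max))
      first : First (ZeroWindow (at word)) k
      first = first-insert loop insertion (proj₂ max) legal-v
      glued : LegalWord (suc n)
      glued = word , trans (count-total insertion loop) (cong (_+ a) total-v) ,
        legal-insert loop insertion (proj₂ max) legal-v

    module Cut (w : Vec Letter (N + p)) (total-w : count (at w) (N + p) ≡ 0 +[ a ] suc n)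
      (legal-w : Legal (at w) (N + p)) where

      found : ∃[ k ] k ≤ N × First (ZeroWindow (at w)) k
      found = first-zeroWindow (at w) n total-w
      k : ℕ
      k = proj₁ found
      first : First (ZeroWindow (at w)) k
      first = proj₂ (proj₂ found)
      ℓ : Vec Letter p
      ℓ = tab p (extend k (at w))
      v : Vec Letter N
      v = tab N (remove k (at w))
      e : downsᵛ ℓ ≡ a
      e = trans (sym (count-at ℓ)) (trans (count-cong p (at-tab (extend k (at w))))
        (total (extend-loop {k} {at w} (proj₁ first))))
      loop : Loop (cycle ℓ)
      loop = cycle-loop ℓ e
      insertion : Insertion k (cycle ℓ) (at v) N (at w)
      insertion = remove-insertion (proj₁ (proj₂ found))
      total-v : count (at v) N ≡ 0 +[ a ] n
      total-v = +-cancelʳ-≡ a _ _ (trans (sym (count-total insertion loop)) total-w)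
      legal-v : Legal (at v) N
      legal-v = legal-remove loop insertion legal-w
      end : excess (at w) (cycle ℓ) (N + p) ≡ 0ℤ
      end = trans (cong₂ _⊖_ total-w (gain+[] loop 0 (suc n))) (ℤ.n⊖n≡0 (0 +[ a ] suc n))
      max : FirstMax (excess (at v) (cycle ℓ)) N k
      max = firstMax-remove loop insertion legal-w (proj₂ first) end

    glue : Combination p a × LegalWord n → LegalWord (suc n)
    glue ((ℓ , e) , (v , total-v , legal-v)) = Glue.glued ℓ e v total-v legal-v

    cut : LegalWord (suc n) → Combination p a × LegalWord n
    cut (w , total-w , legal-w) = (ℓ , e) , (v , total-v , legal-v)
      where open Cut w total-w legal-w

    -- By `firstMax-remove` the place of the cut is the first maximum, where `glue` inserts; place,
    -- loop and v then determine the word.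
    glue∘cut : ∀ u → glue (cut u) ≡ u
    glue∘cut (w , total-w , legal-w) = legalWord-≡ {suc n} (at-injective
      (insertion-functional {v = at X.v} (subst (λ k → Insertion k (cycle X.ℓ) (at X.v) N (at Y.word))
        (firstMax-unique (proj₂ Y.max) X.max) Y.insertion) X.insertion))
      where
      module X = Cut w total-w legal-w
      module Y = Glue X.ℓ X.e X.v X.total-v X.legal-v

    -- By `first-insert` the place of insertion is the first zero-sum window, where `cut` removes;
    -- place and word then determine ℓ and v.
    cut∘glue : ∀ u → cut (glue u) ≡ u
    cut∘glue ((ℓ , e) , (v , total-v , legal-v)) = cong₂ _,_
      (combination-≡ (at-injective (insertion-injective-cycle {ℓ = Y.ℓ} {ℓ′ = ℓ} Y-insertion X.insertion)))
      (legalWord-≡ {n} (at-injective (insertion-injective-word Y-insertion X.insertion)))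
      where
      module X = Glue ℓ e v total-v legal-v
      module Y = Cut X.word (proj₁ (proj₂ X.glued)) (proj₂ (proj₂ X.glued))
      Y-insertion : Insertion X.k (cycle Y.ℓ) (at Y.v) N (at X.word)
      Y-insertion = subst (λ k → Insertion k (cycle Y.ℓ) (at Y.v) N (at X.word))
        (first-unique Y.first X.first) Y.insertion

    legalWord-suc : LegalWord (suc n) ↔ (Combination p a × LegalWord n)
    legalWord-suc = mk↔ₛ′ cut glue cut∘glue glue∘cut

  legalWord↔ : ∀ n → LegalWord n ↔ Fin ((p C a) ^ n)
  legalWord↔ zero = mk↔ₛ′ (λ _ → Fin.zero) (λ _ → [] , refl , λ i q j<0 → ⊥-elim (ℕₚ.n≮0 j<0))
    (λ { Fin.zero → refl ; (Fin.suc ()) }) (λ { ([] , e , l) → legalWord-≡ {0} refl })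
  legalWord↔ (suc n) = ↔-trans (legalWord-suc {n}) (↔-trans (combination↔ p a ×-↔ legalWord↔ n) (↔-sym *↔×))

-- Zero-sum factors

module Heights (a b : ℕ) where

  height : Seq → ℕ → ℤ
  height f zero    = 0ℤ
  height f (suc m) = height f m ℤ.+ val a b (f m)

  height-uncons : ∀ f m → height f (suc m) ≡ val a b (f 0) ℤ.+ height (f ∘ suc) m
  height-uncons f zero    = ℤ.+-comm 0ℤ (val a b (f 0))
  height-uncons f (suc m) = trans (cong (ℤ._+ val a b (f (suc m))) (height-uncons f m))
    (ℤ.+-assoc (val a b (f 0)) (height (f ∘ suc) m) (val a b (f (suc m))))

  wordSum≡height : ∀ {N} (w : Vec Letter N) → wordSum a b w ≡ height (at w) N
  wordSum≡height []      = refl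
  wordSum≡height {suc N} (x ∷ w) = trans
    (cong (λ z → val a b x ℤ.+ z) (wordSum≡height w)) (sym (height-uncons (at (x ∷ w)) N))

  height+segSum : ∀ {N} (w : Vec Letter N) {i j} → i ≤ j → j ≤ N →
    height (at w) i ℤ.+ segSum a b w i j ≡ height (at w) j
  height+segSum [] z≤n z≤n = refl
  height+segSum (x ∷ w) {zero} {zero} _ _ = refl
  height+segSum (x ∷ w) {zero} {suc j} z≤n (s≤s j≤N) = begin
    0ℤ ℤ.+ (val a b x ℤ.+ segSum a b w 0 j)  ≡⟨ ℤ.+-identityˡ _ ⟩
    val a b x ℤ.+ segSum a b w 0 j           ≡⟨ cong (λ z → val a b x ℤ.+ z) (ℤ.+-identityˡ _) ⟨
    val a b x ℤ.+ (0ℤ ℤ.+ segSum a b w 0 j)  ≡⟨ cong (λ z → val a b x ℤ.+ z) (height+segSum w z≤n j≤N) ⟩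
    val a b x ℤ.+ height (at w) j            ≡⟨ height-uncons (at (x ∷ w)) j ⟨
    height (at (x ∷ w)) (suc j)              ∎
    where open ≡-Reasoning
  height+segSum (x ∷ w) {suc i} {suc j} (s≤s i≤j) (s≤s j≤N) = begin
    height (at (x ∷ w)) (suc i) ℤ.+ segSum a b w i j
      ≡⟨ cong (ℤ._+ segSum a b w i j) (height-uncons (at (x ∷ w)) i) ⟩
    val a b x ℤ.+ height (at w) i ℤ.+ segSum a b w i j            ≡⟨ ℤ.+-assoc (val a b x) _ _ ⟩
    val a b x ℤ.+ (height (at w) i ℤ.+ segSum a b w i j)          ≡⟨ cong (λ z → val a b x ℤ.+ z) (height+segSum w i≤j j≤N) ⟩
    val a b x ℤ.+ height (at w) j                                 ≡⟨ height-uncons (at (x ∷ w)) j ⟨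
    height (at (x ∷ w)) (suc j)                                   ∎
    where open ≡-Reasoning

  segSum≡0⇒height : ∀ {N} (w : Vec Letter N) {i j} → i ≤ j → j ≤ N →
    segSum a b w i j ≡ 0ℤ → height (at w) i ≡ height (at w) j
  segSum≡0⇒height w {i} i≤j j≤N eq = trans (sym (ℤ.+-identityʳ _))
    (trans (cong (λ z → height (at w) i ℤ.+ z) (sym eq)) (height+segSum w i≤j j≤N))

  height⇒segSum≡0 : ∀ {N} (w : Vec Letter N) {i j} → i ≤ j → j ≤ N →
    height (at w) i ≡ height (at w) j → segSum a b w i j ≡ 0ℤ
  height⇒segSum≡0 w {i} i≤j j≤N eq = ∙-cancelˡ (height (at w) i) _ _
    (trans (height+segSum w i≤j j≤N) (trans (sym eq) (sym (ℤ.+-identityʳ _))))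

  p : ℕ
  p = a + b

  -- Adding a + b to a letter -b turns it into +a, and a word of m letters +a has sum m a.
  height-count : ∀ f m → height f m ℤ.+ ℤ.+ (count f m * p) ≡ ℤ.+ (m * a)
  height-count f zero = refl
  height-count f (suc m) with f m
  ... | plusA = trans (up (height f m) (ℤ.+ a) (ℤ.+ (count f m * p)))
    (cong (λ z → ℤ.+ a ℤ.+ z) (height-count f m))
    where
    up : ∀ h x y → (h ℤ.+ x) ℤ.+ y ≡ x ℤ.+ (h ℤ.+ y)
    up = solve-∀
  ... | minusB = trans (down (height f m) (ℤ.+ a) (ℤ.+ b) (ℤ.+ (count f m * p)))
    (cong (λ z → ℤ.+ a ℤ.+ z) (height-count f m))
    where
    down : ∀ h x y z → (h ℤ.+ (ℤ.- y)) ℤ.+ ((x ℤ.+ y) ℤ.+ z) ≡ x ℤ.+ (h ℤ.+ z)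
    down = solve-∀

  -- Subtraction-free form of the difference of two heights, which turns their equality into an
  -- equation of natural numbers.
  height-exchange : ∀ f i j →
    height f j ℤ.+ ℤ.+ (i * a + count f j * p) ≡ height f i ℤ.+ ℤ.+ (j * a + count f i * p)
  height-exchange f i j = begin
    hⱼ ℤ.+ (ℤ.+ (i * a) ℤ.+ cⱼ)    ≡⟨ cong (λ z → hⱼ ℤ.+ (z ℤ.+ cⱼ)) (height-count f i) ⟨
    hⱼ ℤ.+ ((hᵢ ℤ.+ cᵢ) ℤ.+ cⱼ)    ≡⟨ swap hᵢ hⱼ cᵢ cⱼ ⟩
    hᵢ ℤ.+ ((hⱼ ℤ.+ cⱼ) ℤ.+ cᵢ)    ≡⟨ cong (λ z → hᵢ ℤ.+ (z ℤ.+ cᵢ)) (height-count f j) ⟩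
    hᵢ ℤ.+ (ℤ.+ (j * a) ℤ.+ cᵢ)    ∎
    where
    open ≡-Reasoning
    hᵢ hⱼ cᵢ cⱼ : ℤ
    hᵢ = height f i
    hⱼ = height f j
    cᵢ = ℤ.+ (count f i * p)
    cⱼ = ℤ.+ (count f j * p)
    swap : ∀ h h′ c c′ → h′ ℤ.+ ((h ℤ.+ c) ℤ.+ c′) ≡ h ℤ.+ ((h′ ℤ.+ c′) ℤ.+ c)
    swap = solve-∀

  height≡⇒ : ∀ f i j → height f i ≡ height f j → i * a + count f j * p ≡ j * a + count f i * p
  height≡⇒ f i j eq = ℤ.+-injective (∙-cancelˡ (height f j) _ _
    (trans (height-exchange f i j) (cong (ℤ._+ ℤ.+ (j * a + count f i * p)) eq)))

  ⇒height≡ : ∀ f i j → i * a + count f j * p ≡ j * a + count f i * p → height f i ≡ height f j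
  ⇒height≡ f i j eq = sym (∙-cancelʳ (ℤ.+ (i * a + count f j * p)) _ _
    (trans (height-exchange f i j) (cong (λ z → height f i ℤ.+ ℤ.+ z) (sym eq))))

  count-mono : ∀ f i l → ∃[ e ] count f (i + l) ≡ count f i + e
  count-mono f i zero    = 0 , trans (cong (count f) (+-identityʳ i)) (sym (+-identityʳ _))
  count-mono f i (suc l) with count-mono f i l
  ... | e , eq = downs (f (i + l)) + e , (begin
    count f (i + suc l)                     ≡⟨ cong (count f) (+-suc i l) ⟩
    downs (f (i + l)) + count f (i + l)     ≡⟨ cong (λ z → downs (f (i + l)) + z) eq ⟩
    downs (f (i + l)) + (count f i + e)     ≡⟨ x∙yz≈y∙xz (downs (f (i + l))) (count f i) e ⟩
    count f i + (downs (f (i + l)) + e)     ∎)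
    where open ≡-Reasoning

  +[]⇒height≡ : ∀ f i q → count f (i +[ p ] q) ≡ count f i +[ a ] q → height f i ≡ height f (i +[ p ] q)
  +[]⇒height≡ f i q eq = ⇒height≡ f i (i +[ p ] q) (begin
    i * a + count f (i +[ p ] q) * p            ≡⟨ cong (λ z → i * a + z * p) (trans eq (+[]≡+* _ a q)) ⟩
    i * a + (count f i + q * a) * p             ≡⟨ rearrange i a (count f i) q p ⟩
    (i + q * p) * a + count f i * p             ≡⟨ cong (λ z → z * a + count f i * p) (+[]≡+* i p q) ⟨
    (i +[ p ] q) * a + count f i * p            ∎)
    where
    open ≡-Reasoning
    rearrange : ∀ i a c q p → i * a + (c + q * a) * p ≡ (i + q * p) * a + c * p
    rearrange = ℕ-solve-∀

  module _ .{{_ : NonZero p}} (coprime : Coprime p a) where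

    -- If the factor has length l and e letters -b, equal heights give a l = e p. As p is coprime to
    -- a, it divides l, and the quotient q satisfies e = q a.
    height≡⇒+[] : ∀ f {i j} → i ≤ j → height f i ≡ height f j →
      ∃[ q ] i +[ p ] q ≡ j × count f j ≡ count f i +[ a ] q
    height≡⇒+[] f {i} {j} i≤j eq with j ∸ i | m+[n∸m]≡n i≤j
    ... | l | refl with count-mono f i l
    ...   | e , count-j = go (coprime-divisor {o = l} coprime (divides e la≡ep))
      where
      open ≡-Reasoning
      left : ∀ i a c p l → i * a + c * p + a * l ≡ (i + l) * a + c * p
      left = ℕ-solve-∀
      right : ∀ i a c p e → i * a + (c + e) * p ≡ i * a + c * p + e * p
      right = ℕ-solve-∀
      swap : ∀ a q p → a * (q * p) ≡ (q * a) * p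
      swap = ℕ-solve-∀
      la≡ep : a * l ≡ e * p
      la≡ep = +-cancelˡ-≡ (i * a + count f i * p) _ _ (begin
        i * a + count f i * p + a * l   ≡⟨ left i a (count f i) p l ⟩
        (i + l) * a + count f i * p     ≡⟨ height≡⇒ f i (i + l) eq ⟨
        i * a + count f (i + l) * p     ≡⟨ cong (λ z → i * a + z * p) count-j ⟩
        i * a + (count f i + e) * p     ≡⟨ right i a (count f i) p e ⟩
        i * a + count f i * p + e * p   ∎)
      go : p ∣ l → ∃[ q ] i +[ p ] q ≡ i + l × count f (i + l) ≡ count f i +[ a ] q
      go (divides q l≡qp) = q , trans (+[]≡+* i p q) (cong (λ z → i + z) (sym l≡qp)) , (begin
        count f (i + l)     ≡⟨ count-j ⟩
        count f i + e       ≡⟨ cong (λ z → count f i + z) e≡qa ⟩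
        count f i + q * a   ≡⟨ +[]≡+* (count f i) a q ⟨
        count f i +[ a ] q  ∎)
        where
        e≡qa : e ≡ q * a
        e≡qa = *-cancelʳ-≡ e (q * a) p (trans (sym la≡ep) (trans (cong (a *_) l≡qp) (swap a q p)))

    +[]-injective : ∀ {m n} → 0 +[ p ] m ≡ 0 +[ p ] n → m ≡ n
    +[]-injective {m} {n} eq = *-cancelʳ-≡ m n p (trans (sym (+[]≡+* 0 p m)) (trans eq (+[]≡+* 0 p n)))

    open Periodic p a

    module _ (n : ℕ) (w : Vec Letter (0 +[ p ] n)) where

      zeroSum⇒count : ZeroSum a b w → count (at w) (0 +[ p ] n) ≡ 0 +[ a ] n
      zeroSum⇒count zs with height≡⇒+[] (at w) {0} {0 +[ p ] n} z≤n (trans (sym zs) (wordSum≡height w))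
      -- The length p q of the whole word is p n, hence q = n.
      ... | q , len , eq = trans eq (cong (0 +[ a ]_) (+[]-injective {q} {n} len))

      count⇒zeroSum : count (at w) (0 +[ p ] n) ≡ 0 +[ a ] n → ZeroSum a b w
      count⇒zeroSum eq = trans (wordSum≡height w) (sym (+[]⇒height≡ (at w) 0 n eq))

    -- `segSum` is half-open, so the end of the factor and the place k of the -b after it are the
    -- same number j + 1.
    legal⇒¬illegal : ∀ {N} (w : Vec Letter N) → Legal (at w) N → ¬ HasIllegal a b w
    legal⇒¬illegal {N} w legal (i , j , i≤j , sum≡0 , wi , k , k≡1+j , wk)
      with height≡⇒+[] (at w) i≤k (segSum≡0⇒height w i≤k (<⇒≤ (toℕ<n k))
        (subst (λ x → segSum a b w (toℕ i) x ≡ 0ℤ) (sym k≡1+j) sum≡0))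
      where
      i≤k : toℕ i ≤ toℕ k
      i≤k = ≤-trans i≤j (≤-trans (n≤1+n _) (≤-reflexive (sym k≡1+j)))
    ... | q , k≡ , eq = legal (toℕ i) q (subst (_< N) (sym k≡) (toℕ<n k)) (trans (cong (count (at w)) k≡) eq)
      (trans (at-lookup w i) wi) (trans (cong (at w) k≡) (trans (at-lookup w k) wk))

    ¬illegal⇒legal : ∀ {N} (w : Vec Letter N) → ¬ HasIllegal a b w → Legal (at w) N
    ¬illegal⇒legal {N} w ¬illegal i q k<N eq wi wk = go (i +[ p ] q) k<N wk (x≤x+[] i p q) (+[]⇒height≡ (at w) i q eq)
      where
      go : ∀ k → k < N → at w k ≡ minusB → i ≤ k → height (at w) i ≡ height (at w) k → ⊥
      go k k<N wk i≤k eq with m≤n⇒m<n∨m≡n i≤k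
      -- `Legal` also speaks of the empty factor, for which one letter would be both +a and -b.
      -- Otherwise k is a successor, and its predecessor is the last place of the factor.
      ... | inj₂ refl = plusA≢minusB wi wk
      go (suc j) k<N wk i≤k eq | inj₁ (s≤s i≤j) = ¬illegal
        ( fromℕ< i<N , fromℕ< j<N
        , subst₂ _≤_ (sym (toℕ-fromℕ< i<N)) (sym (toℕ-fromℕ< j<N)) i≤j
        , subst₂ (λ x y → segSum a b w x (suc y) ≡ 0ℤ) (sym (toℕ-fromℕ< i<N)) (sym (toℕ-fromℕ< j<N))
            (height⇒segSum≡0 w i≤k (<⇒≤ k<N) eq)
        , lookup-fromℕ< i<N wi
        , fromℕ< k<N , trans (toℕ-fromℕ< k<N) (cong suc (sym (toℕ-fromℕ< j<N)))
        , lookup-fromℕ< k<N wk )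
        where
        j<N : j < N
        j<N = <-trans (n<1+n j) k<N
        i<N : i < N
        i<N = ≤-<-trans i≤j j<N
        lookup-fromℕ< : ∀ {m x} (m<N : m < N) → at w m ≡ x → lookup w (fromℕ< m<N) ≡ x
        lookup-fromℕ< m<N eq = trans (sym (at-lookup w (fromℕ< m<N))) (trans (cong (at w) (toℕ-fromℕ< m<N)) eq)

    open Bijection p a

    -- The length enters through an equation because (a + b) n and the bracketed sum agree only
    -- propositionally; matching on `refl` avoids transporting words.
    zeroSumWord↔legalWord : ∀ n {N} → N ≡ 0 +[ p ] n →
      (Σ (Vec Letter N) λ w → ZeroSum a b w × ¬ HasIllegal a b w) ↔ LegalWord n
    zeroSumWord↔legalWord n refl = mk↔ₛ′
      (λ (w , zs , ¬illegal) → w , zeroSum⇒count n w zs , ¬illegal⇒legal w ¬illegal)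
      (λ (w , total , legal) → w , count⇒zeroSum n w total , legal⇒¬illegal w legal)
      (λ _ → legalWord-≡ {n} refl)
      (λ (w , zs , ¬illegal) → cong (λ x → w , x , ¬illegal) (≡-irrelevantℤ _ zs))
      where
      ≡-irrelevantℤ : ∀ {x y : ℤ} (e e′ : x ≡ y) → e ≡ e′
      ≡-irrelevantℤ = Decidable⇒UIP.≡-irrelevant ℤ._≟_

theorem1 : (a b n : ℕ) → 1 ≤ a → 1 ≤ b → gcd a b ≡ 1 →
    (Σ (Vec Letter ((a + b) * n))
    (λ w → ZeroSum a b w × ¬ HasIllegal a b w))
    ↔ Fin (((a + b) C a) ^ n)
theorem1 a b n 1≤a _ gcd≡1 = ↔-trans
  (Heights.zeroSumWord↔legalWord a b coprime n (trans (*-comm (a + b) n) (sym (+[]≡+* 0 (a + b) n))))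
  (Bijection.legalWord↔ (a + b) a n)
  where
  instance
    p≢0 : NonZero (a + b)
    p≢0 = ℕ.>-nonZero (≤-trans 1≤a (m≤m+n a b))
  -- A common divisor of a + b and a also divides b.
  coprime : Coprime (a + b) a
  coprime = coprime-+ (Coprimality.sym (gcd≡1⇒coprime gcd≡1))
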